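{- For every integer $n\geq 4$ with $n\equiv 0$ or $1 \pmod 3$, there exists an equitably 2-chromatic $P_4$ system of order $n$.
   Context: $P_4=(a_1,a_2,a_3,a_4)$ denotes the path on four distinct vertices with edges $\{a_1,a_2\},\{a_2,a_3\},\{a_3,a_4\}$. A $P_4$ system of order $n>1$ is a pair $(V,\mathcal B)$ where $|V|=n$ and $\mathcal B$ is a set of $P_4$ paths with vertices in $V$ whose edge sets partition the edge set of the complete graph on $V$. A $k$-colouring of $(V,\mathcal B)$ is a partition of $V$ into $k$ (possibly empty) colour classes such that no path in $\mathcal B$ is monochromatic. The system is $k$-colourable if it has a $k$-colouring, and $k$-chromatic if it is $k$-colourable but not $(k-1)$-colourable. A colouring is equitable if the cardinalities of the colour classes differ by at most one. The system is equitably $k$-chromatic if it is $k$-chromatic and admits an equitable $k$-colouring. -}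

module Defs where

open import Data.Fin.Base using (Fin)
open import Data.Fin.Properties using (_≟_)
open import Data.Fin.Subset using (Subset; ∣_∣)
open import Data.List.Base using (List; []; _∷_; length; lookup)
open import Data.List.Membership.Propositional using (_∈_)
open import Data.List.Relation.Unary.All using (All)
open import Data.List.Relation.Unary.Unique.Propositional using (Unique)
open import Data.Nat.Base using (ℕ; pred; _≤_; _<_; ∣_-_∣)
open import Data.Product using (_×_; _,_; ∃; ∃-syntax; ∃!)
open import Data.Sum.Base using (_⊎_)
open import Data.Vec.Base using (tabulate)
open import Relation.Binary.PropositionalEquality using (_≡_; _≢_)
open import Relation.Nullary using (¬_; does)

record P₄ (V : Set) : Set where
  constructor mkP₄
  field
    a₁ a₂ a₃ a₄ : V
    distinct    : Unique (a₁ ∷ a₂ ∷ a₃ ∷ a₄ ∷ [])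

  vertices : List V
  vertices = a₁ ∷ a₂ ∷ a₃ ∷ a₄ ∷ []

  -- Oriented along the path; Joins forgets the orientation.
  edges : List (V × V)
  edges = (a₁ , a₂) ∷ (a₂ , a₃) ∷ (a₃ , a₄) ∷ []

  Joins : V → V → Set
  Joins u v = (u , v) ∈ edges ⊎ (v , u) ∈ edges

-- The vertex set is Fin n. The set of paths is given by a list; partition
-- says that each edge of the complete graph belongs to the path at exactly one
-- position, so no path is listed twice, whether forwards or reversed. That
-- the edges of the paths are edges of the complete graph is P₄.distinct.
record P₄System (n : ℕ) : Set where
  field
    order>1   : 1 < n
    paths     : List (P₄ (Fin n))
    partition : ∀ (u v : Fin n) → u ≢ v →
                ∃! _≡_ λ (i : Fin (length paths)) → P₄.Joins (lookup paths i) u v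

-- A partition of the vertices into k possibly empty classes, labelled by Fin k.
Colours : ℕ → ℕ → Set
Colours n k = Fin n → Fin k

colourClass : ∀ {n k} → Colours n k → Fin k → Subset n
colourClass f c = tabulate λ v → does (f v ≟ c)

Monochromatic : ∀ {n k} → Colours n k → P₄ (Fin n) → Set
Monochromatic f p = ∃[ c ] All (λ v → f v ≡ c) (P₄.vertices p)

IsColouring : ∀ {n k} → P₄System n → Colours n k → Set
IsColouring S f = All (λ p → ¬ Monochromatic f p) (P₄System.paths S)

Equitable : ∀ {n k} → Colours n k → Set
Equitable {k = k} f =
  ∀ (c d : Fin k) → ∣ ∣ colourClass f c ∣ - ∣ colourClass f d ∣ ∣ ≤ 1

Colourable : ∀ {n} → P₄System n → ℕ → Set
Colourable {n} S k = ∃ λ (f : Colours n k) → IsColouring S f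

-- For k = 0 this is false, as it should be: vertices exist, so there is no
-- colouring with 0 classes.
Chromatic : ∀ {n} → P₄System n → ℕ → Set
Chromatic S k = Colourable S k × ¬ Colourable S (pred k)

EquitablyChromatic : ∀ {n} → P₄System n → ℕ → Set
EquitablyChromatic {n} S k =
  Chromatic S k × ∃ λ (f : Colours n k) → IsColouring S f × Equitable f

{-# OPTIONS --safe #-}
-- The vertices are m triples and a core of c vertices, where c is 1 or 6, and
-- they are coloured alternately along 0, 1, 2, …. A new triple T is added in
-- front: the edges between T and an older triple form a K₃,₃, which splits into
-- three paths, and the edges inside T together with those from T to the core
-- are split by hand (K₄ when c = 1, K₉ minus K₆ when c = 6). Each piece meets
-- both colours whether or not the alternations on its two blocks are in phase,
-- so it can be reused at every distance.
module Submission where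

open import Defs
open import Data.Fin.Base using (Fin; zero; suc; _↑ˡ_; _↑ʳ_; lift; join; opposite; splitAt)
open import Data.Fin.Patterns using (0F; 1F; 2F; 3F; 4F; 5F; 6F; 7F; 8F)
open import Data.Fin.Properties
  using (_≟_; all?; any?; join-splitAt; lift-injective; ↑ˡ-injective; ↑ʳ-injective)
import Data.Fin.Properties as Fin
open import Data.Fin.Subset using (∣_∣)
open import Data.List.Base using (List; []; _∷_; _++_; filter; length; lookup; map)
open import Data.List.Membership.Propositional using (lose)
open import Data.List.Membership.Propositional.Properties using (∈-lookup; ∈-map⁺; ∈-map⁻)
open import Data.List.Properties using (filter-++; filter-none; filter-some; filter-≐; length-++)
open import Data.List.Relation.Unary.All as All using (All; []; _∷_)
open import Data.List.Relation.Unary.All.Properties using (++⁺; map⁺)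
import Data.List.Relation.Unary.Any as Any
open import Data.List.Relation.Unary.Unique.DecPropositional using (unique?)
import Data.List.Relation.Unary.Unique.Propositional.Properties as Unique
open import Data.Nat using (ℕ; zero; suc; _+_; _*_; _/_; _%_; _≥_; _<_; _≤_;
  ∣_-_∣; ⌈_/2⌉; ⌊_/2⌋; z≤n; s≤s)
open import Data.Nat.DivMod using (m≡m%n+[m/n]*n)
open import Data.Nat.Properties using (+-comm; <⇒≢; suc-injective; ∣-∣-comm; ∣n-n∣≡0; ≤-trans)
  renaming (_≟_ to _≟ℕ_)
open import Data.Product as Product using (∃; ∃!; _×_; _,_)
open import Data.Product.Properties using (≡-dec)
open import Data.Sum as Sum using (_⊎_; inj₁; inj₂; [_,_]; [_,_]′; swap)
open import Function using (_∘_)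
open import Function.Definitions using (Injective)
open import Relation.Binary.PropositionalEquality
  using (_≡_; _≢_; _≗_; refl; sym; trans; cong; cong₂; subst; subst₂)
open import Relation.Nullary using (¬_; Dec; yes; no; contradiction; ¬?; _⊎-dec_)
open import Relation.Nullary.Decidable as Dec using (True; toWitness; from-yes; _→-dec_; _×-dec_)
open import Relation.Unary using (Decidable)

private variable
  k m n : ℕ
  V W : Set

-- Relabelling paths along injections, and splitting vertices into blocks

mapP : (f : V → W) → Injective _≡_ _≡_ f → P₄ V → P₄ W
mapP f inj (mkP₄ a b c d distinct) = mkP₄ (f a) (f b) (f c) (f d) (Unique.map⁺ inj distinct)

path : (a b c d : Fin n) → {True (unique? _≟_ (a ∷ b ∷ c ∷ d ∷ []))} → P₄ (Fin n)
path a b c d {distinct} = mkP₄ a b c d (toWitness distinct)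

↑-elim : (P : Fin (m + n) → Set) →
         (∀ i → P (i ↑ˡ n)) → (∀ j → P (m ↑ʳ j)) → ∀ v → P v
↑-elim {m} {n} P left right v =
  subst P (join-splitAt m n v) ([_,_] {C = P ∘ join m n} left right (splitAt m v))

↑ʳ≢↑ˡ : ∀ (i : Fin m) (j : Fin n) → m ↑ʳ j ≢ i ↑ˡ n
↑ʳ≢↑ˡ zero    j ()
↑ʳ≢↑ˡ (suc i) j eq = ↑ʳ≢↑ˡ i j (Fin.suc-injective eq)

lift-↑ˡ : ∀ (g : Fin m → Fin n) (i : Fin k) → lift k g (i ↑ˡ m) ≡ i ↑ˡ n
lift-↑ˡ g zero    = refl
lift-↑ˡ g (suc i) = cong suc (lift-↑ˡ g i)

-- Counting the paths through an edge

module _ {A : Set} {P : A → Set} (P? : Decidable P) where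

  count≡0⇒¬ : ∀ xs → length (filter P? xs) ≡ 0 → ∀ i → ¬ P (lookup xs i)
  count≡0⇒¬ xs eq i p = <⇒≢ (filter-some P? (lose (∈-lookup {xs = xs} i) p)) (sym eq)

  -- Reduces the partition condition to counts, which add up over concatenation and can be computed
  -- on explicit lists.
  count≡1⇒∃! : ∀ xs → length (filter P? xs) ≡ 1 → ∃! _≡_ λ i → P (lookup xs i)
  count≡1⇒∃! (x ∷ xs) eq with P? x
  ... | yes p = zero , p , λ {i} → unique i
    where
    unique : ∀ i → P (lookup (x ∷ xs) i) → zero ≡ i
    unique zero    _ = refl
    unique (suc i) q = contradiction q (count≡0⇒¬ xs (suc-injective eq) i)
  ... | no ¬p with count≡1⇒∃! xs eq
  ...   | i , q , i-unique = suc i , q , λ {j} → unique j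
    where
    unique : ∀ j → P (lookup (x ∷ xs) j) → suc i ≡ j
    unique zero    p = contradiction p ¬p
    unique (suc j) r = cong suc (i-unique r)

length-filter-map : ∀ {A B : Set} {h : A → B} {P : B → Set} {Q : A → Set}
  (P? : Decidable P) (Q? : Decidable Q) →
  (∀ {x} → P (h x) → Q x) → (∀ {x} → Q x → P (h x)) →
  ∀ xs → length (filter P? (map h xs)) ≡ length (filter Q? xs)
length-filter-map P? Q? to from [] = refl
length-filter-map {h = h} P? Q? to from (x ∷ xs) with P? (h x) | Q? x
... | yes _ | yes _ = cong suc (length-filter-map P? Q? to from xs)
... | no  _ | no  _ = length-filter-map P? Q? to from xs
... | yes p | no ¬q = contradiction (to p) ¬q
... | no ¬p | yes q = contradiction (from q) ¬p

joins? : ∀ (u v : Fin n) → Decidable (λ p → P₄.Joins p u v)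
joins? u v p = (Any.any? (≡-dec _≟_ _≟_ (u , v)) (P₄.edges p))
         ⊎-dec (Any.any? (≡-dec _≟_ _≟_ (v , u)) (P₄.edges p))

opaque
  -- Kept opaque so that goals about symbolic lists stay in terms of `count`; it is unfolded for the
  -- basic lemmas and for the checks by evaluation.
  count : Fin n → Fin n → List (P₄ (Fin n)) → ℕ
  count u v L = length (filter (joins? u v) L)

opaque
  unfolding count

  count-++ : ∀ (u v : Fin n) L M → count u v (L ++ M) ≡ count u v L + count u v M
  count-++ u v L M = trans (cong length (filter-++ (joins? u v) L M))
    (length-++ (filter (joins? u v) L))

  count-sym : ∀ (u v : Fin n) L → count u v L ≡ count v u L
  count-sym u v L = cong length (filter-≐ (joins? u v) (joins? v u) (swap , swap) L)

  count≡1⇒∃!Joins : ∀ {u v : Fin n} L → count u v L ≡ 1 →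
                    ∃! _≡_ λ i → P₄.Joins (lookup L i) u v
  count≡1⇒∃!Joins {u = u} {v} L = count≡1⇒∃! (joins? u v) L

-- Counts under an injective relabelling

module _ (f : Fin m → Fin n) (inj : Injective _≡_ _≡_ f) where

  Joins-map⁺ : ∀ u v p → P₄.Joins p u v → P₄.Joins (mapP f inj p) (f u) (f v)
  Joins-map⁺ u v p = Sum.map (∈-map⁺ (Product.map f f)) (∈-map⁺ (Product.map f f))

  Joins-map⁻ : ∀ x y p → P₄.Joins (mapP f inj p) x y →
               ∃ λ u → ∃ λ v → P₄.Joins p u v × x ≡ f u × y ≡ f v
  Joins-map⁻ x y p (inj₁ e) with ∈-map⁻ (Product.map f f) e
  ... | (u , v) , e′ , refl = u , v , inj₁ e′ , refl , refl
  Joins-map⁻ x y p (inj₂ e) with ∈-map⁻ (Product.map f f) e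
  ... | (v , u) , e′ , refl = u , v , inj₂ e′ , refl , refl

  Joins-map-injective : ∀ u v p → P₄.Joins (mapP f inj p) (f u) (f v) → P₄.Joins p u v
  Joins-map-injective u v p e with Joins-map⁻ (f u) (f v) p e
  ... | u′ , v′ , e′ , fu≡ , fv≡ = subst₂ (P₄.Joins p) (sym (inj fu≡)) (sym (inj fv≡)) e′

  opaque
    unfolding count

    count-map : ∀ u v L → count (f u) (f v) (map (mapP f inj) L) ≡ count u v L
    count-map u v L = length-filter-map (joins? (f u) (f v)) (joins? u v)
      (λ {p} → Joins-map-injective u v p) (λ {p} → Joins-map⁺ u v p) L

    -- Both ends of an edge of a relabelled path lie in the image of `f`.
    count-outsideˡ : ∀ u v L → (∀ i → u ≢ f i) → count u v (map (mapP f inj) L) ≡ 0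
    count-outsideˡ u v L out = cong length (filter-none (joins? u v)
      (map⁺ (All.universal (λ p e → let i , _ , _ , u≡fi , _ = Joins-map⁻ u v p e in out i u≡fi) L)))

    count-outsideʳ : ∀ u v L → (∀ i → v ≢ f i) → count u v (map (mapP f inj) L) ≡ 0
    count-outsideʳ u v L out = trans (count-sym u v (map (mapP f inj) L)) (count-outsideˡ v u L out)

-- Edge sets of the pieces

-- The edges are those of K₃₊ₖ minus the Kₖ on the last `k` vertices: what a triple put in front of
-- `k` vertices contributes.
record CoversNew (L : List (P₄ (Fin (3 + k)))) : Set where
  field
    new : ∀ (i : Fin 3) v → i ↑ˡ k ≢ v → count (i ↑ˡ k) v L ≡ 1
    old : ∀ v w → count (3 ↑ʳ v) (3 ↑ʳ w) L ≡ 0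

coversNew? : (L : List (P₄ (Fin (3 + k)))) → Dec (CoversNew L)
coversNew? {k} L = Dec.map′
  (λ (n , o) → record { new = n ; old = o }) (λ c → CoversNew.new c , CoversNew.old c)
  (all? (λ i → all? λ v → ¬? (i ↑ˡ k ≟ v) →-dec (count (i ↑ˡ k) v L ≟ℕ 1))
   ×-dec all? λ v → all? λ w → count (3 ↑ʳ v) (3 ↑ʳ w) L ≟ℕ 0)

Complete : List (P₄ (Fin n)) → Set
Complete L = ∀ u v → u ≢ v → count u v L ≡ 1

-- K₃,₃ with sides 0, 1, 2 and 3, 4, 5. The paths contain in turn the consecutive pairs 0, 1 and 4,
-- 5 and 1, 2 of one side, and such a pair has both colours in either phase.
bipartite : List (P₄ (Fin (3 + 3)))
bipartite = path 0F 3F 1F 4F ∷ path 2F 4F 0F 5F ∷ path 1F 5F 2F 3F ∷ []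

opaque
  unfolding count

  bipartite-ˡˡ : ∀ (i j : Fin 3) → count (i ↑ˡ 3) (j ↑ˡ 3) bipartite ≡ 0
  bipartite-ˡˡ = from-yes
    (all? λ (i : Fin 3) → all? λ (j : Fin 3) → count (i ↑ˡ 3) (j ↑ˡ 3) bipartite ≟ℕ 0)

  bipartite-ˡʳ : ∀ (i j : Fin 3) → count (i ↑ˡ 3) (3 ↑ʳ j) bipartite ≡ 1
  bipartite-ˡʳ = from-yes
    (all? λ (i : Fin 3) → all? λ (j : Fin 3) → count (i ↑ˡ 3) (3 ↑ʳ j) bipartite ≟ℕ 1)

  bipartite-ʳʳ : ∀ (i j : Fin 3) → count (3 ↑ʳ i) (3 ↑ʳ j) bipartite ≡ 0
  bipartite-ʳʳ = from-yes
    (all? λ (i : Fin 3) → all? λ (j : Fin 3) → count (3 ↑ʳ i) (3 ↑ʳ j) bipartite ≟ℕ 0)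

onFirstTriples-injective : Injective _≡_ _≡_ (lift 3 (λ (i : Fin 3) → i ↑ˡ k))
onFirstTriples-injective {k} = lift-injective (_↑ˡ k) (↑ˡ-injective k _ _) 3

skipTriple-injective : Injective _≡_ _≡_ (lift 3 (λ (i : Fin k) → 3 ↑ʳ i))
skipTriple-injective = lift-injective (3 ↑ʳ_) (↑ʳ-injective 3 _ _) 3

shift-injective : Injective _≡_ _≡_ (λ (i : Fin n) → 3 ↑ʳ i)
shift-injective = ↑ʳ-injective 3 _ _

onFirstTriples : ∀ k → P₄ (Fin (3 + 3)) → P₄ (Fin (3 + (3 + k)))
onFirstTriples k = mapP (lift 3 (_↑ˡ k)) onFirstTriples-injective

skipTriple : ∀ k → P₄ (Fin (3 + k)) → P₄ (Fin (3 + (3 + k)))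
skipTriple k = mapP (lift 3 (3 ↑ʳ_)) skipTriple-injective

shift : P₄ (Fin n) → P₄ (Fin (3 + n))
shift = mapP (3 ↑ʳ_) shift-injective

-- The inserted triple takes the second place: `bipartite` joins it to the first triple, while `L`
-- keeps the first triple and jumps over the inserted one.
addTriple : ∀ k → List (P₄ (Fin (3 + k))) → List (P₄ (Fin (3 + (3 + k))))
addTriple k L = map (onFirstTriples k) bipartite ++ map (skipTriple k) L

module _ {k} (L : List (P₄ (Fin (3 + k)))) (covers : CoversNew L) where
  open CoversNew covers

  private
    -- There are three blocks: the first triple, the second triple and the last `k` vertices. `A`
    -- lives on the first two and `B` on the first and the last, so each pair of blocks can be
    -- treated separately.
    A B : Fin (3 + (3 + k)) → Fin (3 + (3 + k)) → ℕ
    A u v = count u v (map (onFirstTriples k) bipartite)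
    B u v = count u v (map (skipTriple k) L)

    sum : ∀ u v {a b} → A u v ≡ a → B u v ≡ b → count u v (addTriple k L) ≡ a + b
    sum u v p q = trans (count-++ u v _ (map (skipTriple k) L)) (cong₂ _+_ p q)

    A-map : ∀ u v → A (lift 3 (_↑ˡ k) u) (lift 3 (_↑ˡ k) v) ≡ count u v bipartite
    A-map u v = count-map (lift 3 (_↑ˡ k)) onFirstTriples-injective u v bipartite

    B-map : ∀ u v → B (lift 3 (3 ↑ʳ_) u) (lift 3 (3 ↑ʳ_) v) ≡ count u v L
    B-map u v = count-map (lift 3 (3 ↑ʳ_)) skipTriple-injective u v L

    3rd∉A : ∀ (j : Fin k) i → 3 ↑ʳ (3 ↑ʳ j) ≢ lift 3 (_↑ˡ k) i
    3rd∉A j (suc (suc (suc i))) eq = ↑ʳ≢↑ˡ i j (↑ʳ-injective 3 _ _ eq)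

    2nd∉B : ∀ (j : Fin 3) i → 3 ↑ʳ (j ↑ˡ k) ≢ lift 3 (3 ↑ʳ_) i
    2nd∉B j (suc (suc (suc i))) eq = ↑ʳ≢↑ˡ j i (sym (↑ʳ-injective 3 _ _ eq))

    A-outʳ : ∀ u (j : Fin k) → A u (3 ↑ʳ (3 ↑ʳ j)) ≡ 0
    A-outʳ u j = count-outsideʳ _ onFirstTriples-injective u _ bipartite (3rd∉A j)

    A-outˡ : ∀ (j : Fin k) v → A (3 ↑ʳ (3 ↑ʳ j)) v ≡ 0
    A-outˡ j v = count-outsideˡ _ onFirstTriples-injective _ v bipartite (3rd∉A j)

    B-outʳ : ∀ u (j : Fin 3) → B u (3 ↑ʳ (j ↑ˡ k)) ≡ 0
    B-outʳ u j = count-outsideʳ _ skipTriple-injective u _ L (2nd∉B j)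

    B-outˡ : ∀ (j : Fin 3) v → B (3 ↑ʳ (j ↑ˡ k)) v ≡ 0
    B-outˡ j v = count-outsideˡ _ skipTriple-injective _ v L (2nd∉B j)

    -- On the later blocks `lift 3` computes, because `3 ↑ʳ` exposes three successors; on the first
    -- block a rewriting is needed.
    1stA : (i : Fin 3) → lift 3 (_↑ˡ k) (i ↑ˡ 3) ≡ i ↑ˡ (3 + k)
    1stA = lift-↑ˡ (_↑ˡ k)

    1stB : (i : Fin 3) → lift 3 (3 ↑ʳ_) (i ↑ˡ k) ≡ i ↑ˡ (3 + k)
    1stB = lift-↑ˡ (3 ↑ʳ_)

    -- Edges to the second triple come from `bipartite`; those inside the first triple or to the
    -- last block come from `L`.
    addTriple-new : ∀ (i : Fin 3) v → i ↑ˡ (3 + k) ≢ v → count (i ↑ˡ (3 + k)) v (addTriple k L) ≡ 1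
    addTriple-new i = ↑-elim (λ v → i ↑ˡ (3 + k) ≢ v → count (i ↑ˡ (3 + k)) v (addTriple k L) ≡ 1)
      (λ j i≢j → sum _ _
        (subst₂ (λ u v → A u v ≡ 0) (1stA i) (1stA j) (trans (A-map _ _) (bipartite-ˡˡ i j)))
        (subst₂ (λ u v → B u v ≡ 1) (1stB i) (1stB j)
          (trans (B-map _ _) (new i _ λ eq →
            i≢j (cong (_↑ˡ (3 + k)) (↑ˡ-injective k _ _ eq))))))
      (↑-elim _
        (λ j _ → sum _ _
          (subst (λ u → A u (3 ↑ʳ (j ↑ˡ k)) ≡ 1) (1stA i)
            (trans (A-map _ (3 ↑ʳ j)) (bipartite-ˡʳ i j)))
          (B-outʳ _ j))
        (λ j _ → sum _ _ (A-outʳ _ j)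
          (subst (λ u → B u (3 ↑ʳ (3 ↑ʳ j)) ≡ 1) (1stB i)
            (trans (B-map _ (3 ↑ʳ j)) (new i _ (↑ʳ≢↑ˡ i j ∘ sym))))))

    addTriple-old : ∀ v w → count (3 ↑ʳ v) (3 ↑ʳ w) (addTriple k L) ≡ 0
    addTriple-old = ↑-elim (λ v → ∀ w → count (3 ↑ʳ v) (3 ↑ʳ w) (addTriple k L) ≡ 0)
      (λ i → ↑-elim (λ w → count (3 ↑ʳ (i ↑ˡ k)) (3 ↑ʳ w) (addTriple k L) ≡ 0)
        (λ j → sum _ _ (trans (A-map (3 ↑ʳ i) (3 ↑ʳ j)) (bipartite-ʳʳ i j)) (B-outʳ _ j))
        (λ j → sum _ _ (A-outʳ _ j) (B-outˡ i _)))
      (λ i → ↑-elim (λ w → count (3 ↑ʳ (3 ↑ʳ i)) (3 ↑ʳ w) (addTriple k L) ≡ 0)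
        (λ j → sum _ _ (A-outˡ i _) (B-outʳ _ j))
        (λ j → sum _ _ (A-outʳ _ j) (trans (B-map (3 ↑ʳ i) (3 ↑ʳ j)) (old i j))))

  coversNew-addTriple : CoversNew (addTriple k L)
  coversNew-addTriple = record { new = addTriple-new ; old = addTriple-old }

-- K₃₊ₙ is the edge-disjoint union of Kₙ on the last `n` vertices, covered by the shifted `M`, and
-- of the edges meeting the first triple, covered by `L`.
complete-++ : ∀ {L : List (P₄ (Fin (3 + n)))} {M} → CoversNew L → Complete M →
              Complete (L ++ map shift M)
complete-++ {n} {L} {M} covers complete = ↑-elim (λ u → ∀ v → Covered u v)
    fromNew
    (λ i → ↑-elim (Covered (3 ↑ʳ i))
      (λ j i≢j → trans (count-sym _ _ (L ++ map shift M)) (fromNew j _ (i≢j ∘ sym)))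
      (λ j i≢j → sum (old i j)
        (trans (count-map _ shift-injective i j M) (complete i j (i≢j ∘ cong (3 ↑ʳ_))))))
  where
  open CoversNew covers
  Covered : Fin (3 + n) → Fin (3 + n) → Set
  Covered u v = u ≢ v → count u v (L ++ map shift M) ≡ 1
  sum : ∀ {u v a b} → count u v L ≡ a → count u v (map shift M) ≡ b →
        count u v (L ++ map shift M) ≡ a + b
  sum {u} {v} p q = trans (count-++ u v L (map shift M)) (cong₂ _+_ p q)
  fromNew : ∀ (i : Fin 3) v → Covered (i ↑ˡ n) v
  fromNew i v i≢v = sum (new i v i≢v)
    (count-outsideˡ _ shift-injective _ v M (λ j eq → ↑ʳ≢↑ˡ i j (sym eq)))

-- Alternating colourings

Proper : Colours n 2 → List (P₄ (Fin n)) → Set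
Proper f = All (λ p → ¬ Monochromatic f p)

proper? : (f : Colours n 2) (L : List (P₄ (Fin n))) → Dec (Proper f L)
proper? f = All.all? λ p → ¬? (any? λ c → All.all? (λ v → f v ≟ c) (P₄.vertices p))

proper-map : ∀ (f : Colours n 2) {g : Colours m 2} (h : Fin m → Fin n) (inj : Injective _≡_ _≡_ h)
             {L} → f ∘ h ≗ g → Proper g L → Proper f (map (mapP h inj) L)
proper-map f {g} h inj f∘h≗g = map⁺ ∘ All.map λ { ¬mono (c , a ∷ b ∷ d ∷ e ∷ []) →
    ¬mono (c , back a ∷ back b ∷ back d ∷ back e ∷ []) }
  where
  back : ∀ {v c} → f (h v) ≡ c → g v ≡ c
  back = trans (sym (f∘h≗g _))

alternate : Fin 2 → Colours n 2
alternate a zero    = a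
alternate a (suc i) = alternate (opposite a) i

-- The phases of the two blocks are independent, since triples inserted between them shift one
-- against the other.
alternateAfter3 : Fin 2 → Fin 2 → Colours (3 + n) 2
alternateAfter3 a b = [ alternate a , alternate b ]′ ∘ splitAt 3

alternate-↑ˡ : ∀ a (i : Fin m) → alternate a (i ↑ˡ n) ≡ alternate a i
alternate-↑ˡ a zero    = refl
alternate-↑ˡ a (suc i) = alternate-↑ˡ (opposite a) i

opposite-involutive₂ : ∀ (a : Fin 2) → opposite (opposite a) ≡ a
opposite-involutive₂ 0F = refl
opposite-involutive₂ 1F = refl

-- Three is odd, so three swaps of the colours amount to one.
alternate-3↑ʳ : ∀ a (i : Fin n) → alternate a (3 ↑ʳ i) ≡ alternate (opposite a) i
alternate-3↑ʳ a i = cong (λ b → alternate b i) (opposite-involutive₂ (opposite a))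

alternateAfter3-opposite : ∀ a (i : Fin (3 + n)) → alternate a i ≡ alternateAfter3 a (opposite a) i
alternateAfter3-opposite a 0F = refl
alternateAfter3-opposite a 1F = refl
alternateAfter3-opposite a 2F = refl
alternateAfter3-opposite a (suc (suc (suc i))) = alternate-3↑ʳ a i

alternateAfter3-lift : ∀ a b b′ (g : Fin m → Fin n) → alternate b ∘ g ≗ alternate b′ →
                       alternateAfter3 a b ∘ lift 3 g ≗ alternateAfter3 a b′
alternateAfter3-lift a b b′ g eq 0F = refl
alternateAfter3-lift a b b′ g eq 1F = refl
alternateAfter3-lift a b b′ g eq 2F = refl
alternateAfter3-lift a b b′ g eq (suc (suc (suc i))) = eq i

-- Both phases are quantified because an inserted triple reverses the phase of everything behind it;
-- one fixed relation between them would not survive `addTriple`.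
AlwaysProper : List (P₄ (Fin (3 + k))) → Set
AlwaysProper L = ∀ a b → Proper (alternateAfter3 a b) L

alwaysProper? : (L : List (P₄ (Fin (3 + k)))) → Dec (AlwaysProper L)
alwaysProper? L = all? λ a → all? λ b → proper? (alternateAfter3 a b) L

alwaysProper-addTriple : ∀ L → AlwaysProper L → AlwaysProper (addTriple k L)
alwaysProper-addTriple L proper a b = ++⁺
  (proper-map (alternateAfter3 a b) (lift 3 (_↑ˡ _)) onFirstTriples-injective
    (alternateAfter3-lift a b b (_↑ˡ _) (alternate-↑ˡ b))
    (from-yes (alwaysProper? bipartite) a b))
  (proper-map (alternateAfter3 a b) (lift 3 (3 ↑ʳ_)) skipTriple-injective
    -- The inserted triple starts with colour `b`, so the vertices behind it start with
    -- `opposite b`.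
    (alternateAfter3-lift a b (opposite b) (3 ↑ʳ_) (alternate-3↑ʳ b))
    (proper a (opposite b)))

-- Class sizes of the alternating colouring

size : Fin 2 → Fin 2 → ℕ → ℕ
size a c n = ∣ colourClass (alternate {n} a) c ∣

-- Mutual induction: removing the first vertex exchanges the roles of the two colours, just as
-- ⌈(n+1)/2⌉ = 1 + ⌊n/2⌋ and ⌊(n+1)/2⌋ = ⌈n/2⌉.
size-same : ∀ a n → size a a n ≡ ⌈ n /2⌉
size-opposite : ∀ a n → size a (opposite a) n ≡ ⌊ n /2⌋

size-same a  zero    = refl
size-same 0F (suc n) = cong suc (size-opposite 1F n)
size-same 1F (suc n) = cong suc (size-opposite 0F n)

size-opposite a  zero    = refl
size-opposite 0F (suc n) = size-same 1F n
size-opposite 1F (suc n) = size-same 0F n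

∣⌈n/2⌉-⌊n/2⌋∣≤1 : ∀ n → ∣ ⌈ n /2⌉ - ⌊ n /2⌋ ∣ ≤ 1
∣⌈n/2⌉-⌊n/2⌋∣≤1 0             = z≤n
∣⌈n/2⌉-⌊n/2⌋∣≤1 1             = s≤s z≤n
∣⌈n/2⌉-⌊n/2⌋∣≤1 (suc (suc n)) = ∣⌈n/2⌉-⌊n/2⌋∣≤1 n

alternate-equitable : ∀ n → Equitable (alternate {n} 0F)
alternate-equitable n 0F 0F = subst (_≤ 1) (sym (∣n-n∣≡0 (size 0F 0F n))) z≤n
alternate-equitable n 1F 1F = subst (_≤ 1) (sym (∣n-n∣≡0 (size 0F 1F n))) z≤n
alternate-equitable n 0F 1F =
  subst₂ (λ x y → ∣ x - y ∣ ≤ 1) (sym (size-same 0F n)) (sym (size-opposite 0F n))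
    (∣⌈n/2⌉-⌊n/2⌋∣≤1 n)
alternate-equitable n 1F 0F =
  subst (_≤ 1) (∣-∣-comm (size 0F 0F n) (size 0F 1F n)) (alternate-equitable n 0F 1F)

-- The systems

-- The base of the induction: `inner` decomposes K on the core, and `outer` attaches a single triple
-- to it.
record Core (c : ℕ) : Set where
  field
    inner          : List (P₄ (Fin c))
    inner-complete : Complete inner
    inner-proper   : ∀ a → Proper (alternate a) inner
    outer          : List (P₄ (Fin (3 + c)))
    outer-covers   : CoversNew outer
    outer-proper   : AlwaysProper outer

opaque
  unfolding count

  core₁ : Core 1
  core₁ = record
    { inner          = []
    ; inner-complete = λ { 0F 0F 0≢0 → contradiction refl 0≢0 }
    ; inner-proper   = λ _ → []
    ; outer          = K₄
    ; outer-covers   = from-yes (coversNew? K₄)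
    ; outer-proper   = from-yes (alwaysProper? K₄)
    }
    where
    K₄ : List (P₄ (Fin 4))
    K₄ = path 0F 1F 2F 3F ∷ path 1F 3F 0F 2F ∷ []

  -- Six is the least multiple of three that works: a core of 0 or 3 vertices would require
  -- splitting a K₃, which has too few vertices for a path.
  core₆ : Core 6
  core₆ = record
    { inner          = K₆
    ; inner-complete = from-yes (all? λ u → all? λ v → ¬? (u ≟ v) →-dec (count u v K₆ ≟ℕ 1))
    ; inner-proper   = from-yes (all? λ a → proper? (alternate a) K₆)
    ; outer          = K₉∖K₆
    ; outer-covers   = from-yes (coversNew? K₉∖K₆)
    ; outer-proper   = from-yes (alwaysProper? K₉∖K₆)
    }
    where
    K₆ : List (P₄ (Fin 6))
    K₆ = path 0F 1F 2F 3F ∷ path 0F 2F 4F 1F ∷ path 0F 3F 1F 5F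
       ∷ path 0F 4F 5F 2F ∷ path 0F 5F 3F 4F ∷ []

    -- Each path contains 0 and 1, or one of the core pairs 5, 6 and 7, 8, hence both colours in
    -- every combination of phases.
    K₉∖K₆ : List (P₄ (Fin 9))
    K₉∖K₆ = path 0F 1F 2F 3F ∷ path 0F 2F 4F 1F ∷ path 0F 3F 1F 5F ∷ path 1F 6F 0F 4F
          ∷ path 0F 5F 2F 6F ∷ path 0F 7F 1F 8F ∷ path 0F 8F 2F 7F ∷ []

-- Order above one gives an edge, hence a path, and with one colour any path is monochromatic.
not-1-colourable : (S : P₄System n) → ¬ Colourable S 1
not-1-colourable {suc (suc n)} S (f , colouring) =
  let i , _ = P₄System.partition S 0F 1F λ () in
  All.lookup colouring (∈-lookup i) (0F , All.universal (λ v → only (f v)) _)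
  where
  only : (c : Fin 1) → c ≡ 0F
  only 0F = refl
not-1-colourable {zero} S = contradiction (P₄System.order>1 S) λ ()
not-1-colourable {suc zero} S = contradiction (P₄System.order>1 S) λ { (s≤s ()) }

module _ {c} (core : Core c) where
  open Core core

  newPaths : ∀ m → List (P₄ (Fin (3 + (m * 3 + c))))
  newPaths zero    = outer
  newPaths (suc m) = addTriple (m * 3 + c) (newPaths m)

  newPaths-covers : ∀ m → CoversNew (newPaths m)
  newPaths-covers zero    = outer-covers
  newPaths-covers (suc m) = coversNew-addTriple (newPaths m) (newPaths-covers m)

  newPaths-proper : ∀ m → AlwaysProper (newPaths m)
  newPaths-proper zero    = outer-proper
  newPaths-proper (suc m) = alwaysProper-addTriple (newPaths m) (newPaths-proper m)

  allPaths : ∀ m → List (P₄ (Fin (m * 3 + c)))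
  allPaths zero    = inner
  allPaths (suc m) = newPaths m ++ map shift (allPaths m)

  allPaths-complete : ∀ m → Complete (allPaths m)
  allPaths-complete zero    = inner-complete
  allPaths-complete (suc m) = complete-++ (newPaths-covers m) (allPaths-complete m)

  -- The start colour varies in the induction, because the older vertices move three places and see
  -- the opposite phase.
  allPaths-proper : ∀ m a → Proper (alternate a) (allPaths m)
  allPaths-proper zero    a = inner-proper a
  allPaths-proper (suc m) a = ++⁺
    (All.map (λ ¬mono (d , mono) →
        ¬mono (d , All.map (λ {v} → trans (sym (alternateAfter3-opposite a v))) mono))
      (newPaths-proper m a (opposite a)))
    (proper-map (alternate a) (3 ↑ʳ_) shift-injective (alternate-3↑ʳ a)
      (allPaths-proper m (opposite a)))

  equitablyChromatic : ∀ m → 1 < m * 3 + c → ∃ λ (S : P₄System (m * 3 + c)) → EquitablyChromatic S 2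
  equitablyChromatic m 1<n =
    S , ((f , proper) , not-1-colourable S) , f , proper , alternate-equitable (m * 3 + c)
    where
    S : P₄System (m * 3 + c)
    S = record
      { order>1   = 1<n
      ; paths     = allPaths m
      ; partition = λ u v u≢v → count≡1⇒∃!Joins (allPaths m) (allPaths-complete m u v u≢v)
      }
    f : Colours (m * 3 + c) 2
    f = alternate 0F
    proper : IsColouring S f
    proper = allPaths-proper m 0F

theorem3p7 : ∀ (n : ℕ) → n ≥ 4 → (n % 3 ≡ 0) ⊎ (n % 3 ≡ 1) →
    ∃ λ (S : P₄System n) → EquitablyChromatic S 2
theorem3p7 n n≥4 (inj₁ n%3≡0) = solve (n / 3)
    (trans (m≡m%n+[m/n]*n n 3) (cong (_+ n / 3 * 3) n%3≡0))
  where
  solve : ∀ q → n ≡ q * 3 → ∃ λ (S : P₄System n) → EquitablyChromatic S 2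
  -- Quotients 0 and 1 are the orders 0 and 3, excluded by `n≥4`.
  solve 0 refl = contradiction n≥4 λ ()
  solve 1 refl = contradiction n≥4 λ { (s≤s (s≤s (s≤s ()))) }
  -- `(2 + m) * 3` computes to `6 + m * 3`: two of the triples become the core, moved to the end.
  solve (suc (suc m)) n≡ with trans n≡ (+-comm 6 (m * 3))
  ... | refl = equitablyChromatic core₆ m (≤-trans (s≤s (s≤s z≤n)) n≥4)
theorem3p7 n n≥4 (inj₂ n%3≡1)
  -- The remainder 1 becomes the single core vertex.
  with trans (m≡m%n+[m/n]*n n 3) (trans (cong (_+ n / 3 * 3) n%3≡1) (+-comm 1 (n / 3 * 3)))
... | n≡ = subst (λ n → ∃ λ (S : P₄System n) → EquitablyChromatic S 2) (sym n≡)
    (equitablyChromatic core₁ (n / 3)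
      (subst (1 <_) n≡ (≤-trans (s≤s (s≤s z≤n)) n≥4)))
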